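{- Algorithm Enhanced-ED-Approx, on input $S,S',N_1,N_2$ and the list-decoders $\mathrm{Dec}_{\mathcal C_1},\mathrm{Dec}_{\mathcal C_2}$, runs in $$O\left(\frac{n}{N_1}\cdot T_{\mathrm{Dec}_{\mathcal C_1}}(N_1)+\frac{n}{N_2}\cdot T_{\mathrm{Dec}_{\mathcal C_2}}(N_2)+\frac{N_2L_1L_2}{\varepsilon^2}\cdot n\log\log n\right)$$ time for $n=\max(|S|,|S'|)$.
   Context: Setting. Let $\varepsilon>0$ be sufficiently small. For $t=1,2$, $\mathcal C_t$ is an insertion-deletion code of block length $N_t$ and rate $r_t$ over alphabet $\Sigma_{\mathcal C_t}$ that is $L_t$-list decodable from $N_t(1-\varepsilon)$ insertions and $N_t(1-\varepsilon)$ deletions, with decoding time $T_{\mathrm{Dec}_{\mathcal C_t}}(N_t)$: for a string $y$, the decoder output $\mathrm{Dec}_{\mathcal C_t}(y)$ is the set (of size at most $L_t$) of all indices $j$ such that the $j$-th codeword of $\mathcal C_t$ can be turned into $y$ by $N_t(1-\varepsilon)$ deletions and $N_t(1-\varepsilon)$ insertions. Let $I'$ be the concatenation of all codewords of $\mathcal C_2$, of length $|I'|=N_2|\Sigma_{\mathcal C_2}|^{N_2r_2}$; the block length of $\mathcal C_1$ is $N_1=|I'|$. Let $I_1$ be the concatenation of all codewords of $\mathcal C_1$, $I_2$ the string $I'$ repeated $|\mathcal C_1|$ times, and $I$ the string with $i$-th symbol $((I_1)_i,(I_2)_i)$. $S$ is the string with $i$-th symbol $(m_i,I_i)$ for an arbitrary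 content string $m$ with $|m|=|I|$; $S'$ is a given string over the same product alphabet. $S$ and $S'$ are split into consecutive blocks $S(i),S'(i)$ of length $N_1$, and each block is split into consecutive sub-blocks of length $N_2$: $S(k,k')$ denotes the $k'$-th sub-block of $S(k)$ and $S'(i,i')$ the $i'$-th sub-block of $S'(i)$. $C'_i$ is the $\mathcal C_1$-index component of $S'(i)$, and $C''_{i,i'}$ is the $\mathcal C_2$-index component of $S'(i,i')$. Algorithm Enhanced-ED-Approx. Let $w=1/\varepsilon$. Start with an empty bipartite graph $G$ with parts of size $|S|$ and $|S'|$, whose vertices are the positions of $S$ and of $S'$. For each block $S'(i)$: set $List_1\leftarrow\mathrm{Dec}_{\mathcal C_1}(C'_i)$; for each $j\in List_1$, for each $k\in[j-w,j+w]$, for each $i'\in[1,N_1/N_2]$: set $List_2\leftarrow\mathrm{Dec}_{\mathcal C_2}(C''_{i,i'})$; for each $j'\in List_2$ and each $k'\in[j'-w,j'+w]$, connect any pair of vertices of $G$ that correspond to identical symbols in $S(k,k')$ and $S'(i,i')$. Finally return a largest non-crossing matching of $G$ (a set of edges $(u_{i_1},v_{j_1}),\dots,(u_{i_t},v_{j_t})$ with $i_1<\dots<i_t$, $j_1<\dots<j_t$), computed by the Hunt–Szymanski algorithm, which finds a largest non-crossing matching of a bipartite graph with $n$ ordered vertices in each part and $r$ edges in $O((n+r)\log\log n)$ time.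
   Formalization: The formal algorithm decodes each sub-block once and stores List_2; recomputing it for all j and k, as the pseudocode literally says, would exceed the (n/N_2)·T_2 term by a factor of order L_1/ε. Also, ε is rational, which is equivalent here. -}

module Defs where

open import Data.Bool.Base using (if_then_else_)
open import Data.Fin.Base as Fin using (Fin; toℕ)
import Data.Fin.Properties as Fin
open import Data.Integer.Base as ℤ using (+_)
open import Data.List.Base as List using (List; []; _∷_; _++_; length; upTo; allFin; take; drop)
open import Data.List.Membership.Propositional using (_∈_)
import Data.List.Membership.DecPropositional as DecMembership
open import Data.List.Relation.Unary.All using (All)
open import Data.List.Relation.Unary.All.Properties using (¬Any⇒All¬)
open import Data.List.Relation.Unary.AllPairs using (AllPairs; []; _∷_)
open import Data.List.Relation.Unary.Unique.Propositional using (Unique)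
open import Data.Maybe.Base using (Maybe; just; nothing)
open import Data.Nat.Base as ℕ using (ℕ; suc; NonZero; _⊔_; _∸_)
open import Data.Nat.Logarithm using (⌊log₂_⌋)
open import Data.Nat.Properties using (m*n≢0)
open import Data.Product.Base using (_×_; _,_; proj₁; proj₂; ∃-syntax)
open import Data.Product.Properties using (≡-dec)
open import Data.Rational.Base as ℚ using (ℚ; 1ℚ; 1/_; floor)
open import Data.Rational.Properties using (pos⇒nonZero)
open import Data.Unit.Base using (⊤; tt)
open import Data.Vec.Base as Vec using (Vec; lookup)
open import Function.Bundles using (_⇔_)
open import Function.Definitions using (Injective)
open import Relation.Binary.Definitions using (DecidableEquality)
open import Relation.Binary.PropositionalEquality.Core using (_≡_)
open import Relation.Nullary.Decidable.Core using (yes; no; does)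

⟦_⟧ : ℕ → ℚ
⟦ n ⟧ = + n ℚ./ 1

recip : (ε : ℚ) .{{_ : ℚ.Positive ε}} → ℚ
recip ε = (1/ ε) {{pos⇒nonZero ε}}

-- Rounding each logarithm down changes log log n by at most a constant factor
-- for n ≥ 4, and makes it vanish for n < 4.
loglog : ℕ → ℕ
loglog n = ⌊log₂ ⌊log₂ n ⌋ ⌋

------------------------------------------------------------------------
-- Running time

-- A computation in the unit-cost RAM model: the number of steps it takes,
-- together with its result.
Timed : Set → Set
Timed A = ℕ × A

time : {A : Set} → Timed A → ℕ
time = proj₁

result : {A : Set} → Timed A → A
result = proj₂

-- Timed computations with a mutable store of type St.
Prog : Set → Set → Set
Prog St A = St → Timed (A × St)

module _ {St : Set} where

  infixl 1 _>>=_ _>>_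

  return : {A : Set} → A → Prog St A
  return a s = 0 , a , s

  _>>=_ : {A B : Set} → Prog St A → (A → Prog St B) → Prog St B
  (p >>= f) s =
    let (c , a , s′) = p s
        (c′ , r)     = f a s′
    in c ℕ.+ c′ , r

  _>>_ : {A B : Set} → Prog St A → Prog St B → Prog St B
  p >> q = p >>= λ _ → q

  charge : ℕ → Prog St ⊤
  charge c s = c , tt , s

  call : {A : Set} → Timed A → Prog St A
  call (c , a) s = c , a , s

  get : Prog St St
  get s = 0 , s , s

  modify : (St → St) → Prog St ⊤
  modify f s = 0 , tt , f s

  -- Every loop test takes one step, including the one that ends the loop.
  forEach : {A : Set} → List A → (A → Prog St ⊤) → Prog St ⊤
  forEach []       body = charge 1
  forEach (x ∷ xs) body = do
    charge 1
    body x
    forEach xs body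

------------------------------------------------------------------------
-- Insertion-deletion codes

-- Turns d i x y: x is turned into y by d single-symbol deletions and
-- i single-symbol insertions, performed in any order.
data Turns {A : Set} : ℕ → ℕ → List A → List A → Set where
  stop   : ∀ {x} → Turns 0 0 x x
  delete : ∀ {d i} xs a ys {y} →
           Turns d i (xs ++ ys) y → Turns (suc d) i (xs ++ a ∷ ys) y
  insert : ∀ {d i} xs a ys {y} →
           Turns d i (xs ++ a ∷ ys) y → Turns d (suc i) (xs ++ ys) y

-- A code over an alphabet of a symbols with block length N and M codewords.
-- Its rate is r = log M / (N log a), so that M is the number a ^ (N r); any M
-- is allowed, as r may be any real number for which a ^ (N r) is an integer.
record Code (a N M : ℕ) : Set where
  field
    codeword  : Fin M → Vec (Fin a) N
    injective : Injective _≡_ _≡_ codeword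

-- List decoding from N(1-ε) insertions and N(1-ε) deletions, with lists of size
-- at most L. The time bound is only required for received strings that are no
-- longer than the block length.
record ListDecoder {a N M : ℕ} (C : Code a N M) (ε : ℚ) (L : ℕ) (T : ℕ → ℕ) : Set where
  open Code C
  field
    decode     : List (Fin a) → Timed (List (Fin M))
    decode-∈   : ∀ y j → j ∈ result (decode y) ⇔
                   (∃[ d ] ∃[ i ] (⟦ d ⟧ ℚ.≤ ⟦ N ⟧ ℚ.* (1ℚ ℚ.- ε)
                                 × ⟦ i ⟧ ℚ.≤ ⟦ N ⟧ ℚ.* (1ℚ ℚ.- ε)
                                 × Turns d i (Vec.toList (codeword j)) y))
    decode-set : ∀ y → Unique (result (decode y))
    listSize   : ∀ y → length (result (decode y)) ℕ.≤ L
    decodeTime : ∀ y → length y ℕ.≤ N → time (decode y) ℕ.≤ T N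

allCodewords : ∀ {a N M} → Code a N M → Vec (Fin a) (M ℕ.* N)
allCodewords C = Vec.concat (Vec.tabulate (Code.codeword C))

-- The string I. The block length of C₁ is the length M₂ * N₂ of
-- I' = allCodewords C₂.
indexString : ∀ {a₁ a₂ M₁ M₂ N₂} → Code a₁ (M₂ ℕ.* N₂) M₁ → Code a₂ N₂ M₂ →
              Vec (Fin a₁ × Fin a₂) (M₁ ℕ.* (M₂ ℕ.* N₂))
indexString {M₁ = M₁} C₁ C₂ =
  Vec.zip (allCodewords C₁) (Vec.concat (Vec.replicate M₁ (allCodewords C₂)))

------------------------------------------------------------------------
-- Bipartite graphs and non-crossing matchings

Edge : ℕ → ℕ → Set
Edge p q = Fin p × Fin q

record BipartiteGraph (p q : ℕ) : Set where
  constructor graph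
  field
    edges  : List (Edge p q)
    simple : Unique edges

  edgeCount : ℕ
  edgeCount = length edges

open BipartiteGraph using (edges; edgeCount)

emptyGraph : ∀ {p q} → BipartiteGraph p q
emptyGraph = graph [] []

connect : ∀ {p q} → Edge p q → BipartiteGraph p q → BipartiteGraph p q
connect e G@(graph es u) with DecMembership._∈?_ (≡-dec Fin._≟_ Fin._≟_) e es
... | yes _    = G
... | no  e∉es = graph (e ∷ es) (¬Any⇒All¬ es e∉es ∷ u)

IsNonCrossingMatching : ∀ {p q} → BipartiteGraph p q → List (Edge p q) → Set
IsNonCrossingMatching G es =
  All (_∈ edges G) es ×
  AllPairs (λ e f → proj₁ e Fin.< proj₁ f × proj₂ e Fin.< proj₂ f) es

IsLargestNonCrossingMatching : ∀ {p q} → BipartiteGraph p q → List (Edge p q) → Set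
IsLargestNonCrossingMatching G es =
  IsNonCrossingMatching G es ×
  (∀ fs → IsNonCrossingMatching G fs → length fs ℕ.≤ length es)

-- The guarantee of the Hunt–Szymanski algorithm. Parts of sizes p and q count
-- as parts of size p ⊔ q, the smaller one being padded with isolated vertices.
record HuntSzymanski : Set where
  field
    match         : ∀ {p q} → BipartiteGraph p q → Timed (List (Edge p q))
    match-largest : ∀ {p q} (G : BipartiteGraph p q) →
                    IsLargestNonCrossingMatching G (result (match G))
    constant      : ℕ
    threshold     : ℕ
    matchTime     : ∀ {p q} (G : BipartiteGraph p q) → threshold ℕ.≤ p ⊔ q →
                    time (match G) ℕ.≤
                      constant ℕ.* ((p ⊔ q ℕ.+ edgeCount G) ℕ.* loglog (p ⊔ q))

------------------------------------------------------------------------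
-- The algorithm

-- All indices, blocks and sub-blocks are numbered from 0.

-- The k-th block of length N; the last one may be shorter, and blocks past the
-- end are empty.
block : {A : Set} → ℕ → ℕ → List A → List A
block N k xs = take N (drop (k ℕ.* N) xs)

blockCount : (N len : ℕ) .{{_ : NonZero N}} → ℕ
blockCount N len = (len ℕ.+ (N ∸ 1)) ℕ./ N

-- The natural numbers in [j - w, j + w].
window : ℚ → ℕ → List ℕ
window w j = List.map ((j ∸ ⌊w⌋) ℕ.+_) (upTo (suc (j ℕ.+ ⌊w⌋) ∸ (j ∸ ⌊w⌋)))
  where
  ⌊w⌋ : ℕ
  ⌊w⌋ = ℤ.∣ floor w ∣

Symbol : Set → ℕ → ℕ → Set
Symbol Γ a₁ a₂ = Γ × (Fin a₁ × Fin a₂)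

module EnhancedEDApprox
  {Γ : Set} (_≟Γ_ : DecidableEquality Γ)
  {a₁ a₂ M₁ M₂ p q : ℕ}
  (HS : HuntSzymanski)
  (ε : ℚ) .{{_ : ℚ.Positive ε}}
  (S : Vec (Symbol Γ a₁ a₂) p) (S′ : Vec (Symbol Γ a₁ a₂) q)
  (N₁ N₂ : ℕ) .{{_ : NonZero N₁}} .{{_ : NonZero N₂}}
  (dec₁ : List (Fin a₁) → Timed (List (Fin M₁)))
  (dec₂ : List (Fin a₂) → Timed (List (Fin M₂)))
  where

  w : ℚ
  w = recip ε

  _≟_ : DecidableEquality (Symbol Γ a₁ a₂)
  _≟_ = ≡-dec _≟Γ_ (≡-dec Fin._≟_ Fin._≟_)

  -- Blocks are represented by the positions they occupy.
  subBlockS : ℕ → ℕ → List (Fin p)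
  subBlockS k k′ = block N₂ k′ (block N₁ k (allFin p))

  blockS′ : ℕ → List (Fin q)
  blockS′ i = block N₁ i (allFin q)

  subBlockS′ : ℕ → ℕ → List (Fin q)
  subBlockS′ i i′ = block N₂ i′ (blockS′ i)

  C′ : ℕ → List (Fin a₁)
  C′ i = List.map (λ v → proj₁ (proj₂ (lookup S′ v))) (blockS′ i)

  C″ : ℕ → ℕ → List (Fin a₂)
  C″ i i′ = List.map (λ v → proj₂ (proj₂ (lookup S′ v))) (subBlockS′ i i′)

  -- List₂ depends on i and i' only, although it is requested anew for all j and
  -- k. It is computed on the first request and stored in a table with one entry
  -- for each sub-block of the current block S'(i); without this the number of
  -- calls of dec₂ would exceed n / N₂ by a factor of order L₁ / ε.
  Memo : Set
  Memo = Vec (Maybe (List (Fin M₂))) (N₁ ℕ./ N₂)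

  record Store : Set where
    constructor store
    field
      G    : BipartiteGraph p q
      memo : Memo

  open Store

  emptyMemo : Memo
  emptyMemo = Vec.replicate (N₁ ℕ./ N₂) nothing

  resetMemo : Prog Store ⊤
  resetMemo = do
    charge (N₁ ℕ./ N₂)
    modify λ s → record s { memo = emptyMemo }

  -- Extracting the index component of a block takes one step per symbol.
  list₁ : ℕ → Prog Store (List (Fin M₁))
  list₁ i = do
    charge (length (C′ i))
    call (dec₁ (C′ i))

  list₂ : ℕ → Fin (N₁ ℕ./ N₂) → Prog Store (List (Fin M₂))
  list₂ i i′ = do
    charge 1
    s ← get
    fromMemo (lookup (memo s) i′)
    where
    fromMemo : Maybe (List (Fin M₂)) → Prog Store (List (Fin M₂))
    fromMemo (just l) = return l
    fromMemo nothing  = do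
      charge (length (C″ i (toℕ i′)))
      l ← call (dec₂ (C″ i (toℕ i′)))
      charge 1
      modify λ s → record s { memo = memo s Vec.[ i′ ]≔ just l }
      return l

  -- One step for comparing the two symbols and one for updating the graph.
  connectIfIdentical : Fin p → Fin q → Prog Store ⊤
  connectIfIdentical u v = do
    charge 1
    if does (lookup S u ≟ lookup S′ v)
      then (charge 1 >> modify λ s → record s { G = connect (u , v) (G s) })
      else return tt

  buildGraph : Prog Store ⊤
  buildGraph =
    forEach (upTo (blockCount N₁ q)) λ i → do
      resetMemo
      l₁ ← list₁ i
      forEach l₁ λ j →
        forEach (window w (toℕ j)) λ k →
          forEach (allFin (N₁ ℕ./ N₂)) λ i′ → do
            l₂ ← list₂ i i′
            forEach l₂ λ j′ →
              forEach (window w (toℕ j′)) λ k′ →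
                forEach (subBlockS k k′) λ u →
                  forEach (subBlockS′ i (toℕ i′)) λ v →
                    connectIfIdentical u v

  program : Prog Store (List (Edge p q))
  program = do
    charge (p ℕ.+ q)  -- setting up the vertices of the empty graph
    buildGraph
    s ← get
    call (HuntSzymanski.match HS (G s))

  run : Timed (List (Edge p q))
  run =
    let (c , matching , _) = program (store emptyGraph emptyMemo)
    in c , matching

instance
  *-nonZero : ∀ {m n} .{{_ : NonZero m}} .{{_ : NonZero n}} → NonZero (m ℕ.* n)
  *-nonZero {m} {n} = m*n≢0 m n

{-# OPTIONS --safe #-}
module Submission where

-- Since N₁ ≤ |S| ≤ n, there are at most 2n / N₁ blocks S′(i), each with at most
-- N₁ / N₂ sub-blocks; the first decoder is called once per block. The calls of
-- the second one are charged to the unknown entries of the memo table, one call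
-- per entry: the potential is the number of these entries times the cost of a
-- call. Apart from the decoders the nested loops take a constant number of steps
-- per innermost iteration, and there are at most (2n / N₂) L₁ L₂ (3 / ε)² N₂² of
-- these. The number of edges is bounded by the number of innermost iterations
-- and not by the running time, so that the decoding times do not enter the
-- Hunt–Szymanski bound. Constant terms are absorbed because L₁, L₂ and 1 / ε are
-- at least 1: every codeword is on its own list.

open import Defs
open import Data.Bool.Base using (true; false)
open import Data.Fin.Base using (Fin; zero; suc; toℕ)
import Data.Fin.Properties as Fin
open import Data.Integer.Base as ℤ using (+_)
import Data.Integer.DivMod as ℤ
import Data.Integer.Properties as ℤ
open import Data.List.Base using (List; []; _∷_; length; allFin; upTo; drop)
import Data.List.Membership.DecPropositional as DecMembership
open import Data.List.Membership.Propositional using (_∈_)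
open import Data.List.Membership.Propositional.Properties using (∈-length)
open import Data.List.Properties using (length-map; length-take; length-tabulate; length-upTo)
open import Data.Maybe.Base using (Maybe; just; nothing)
import Data.Maybe.Relation.Unary.All as Maybe
open import Data.Nat.Base as ℕ using (ℕ; zero; suc; NonZero; _⊔_; _∸_; s≤s; z≤n)
open import Data.Nat.DivMod using (m/n*n≤m; m*n/n≡m)
open import Data.Nat.Logarithm using (⌊log₂⌋-mono-≤)
import Data.Nat.Properties as ℕ
open import Data.Nat.Tactic.RingSolver using (solve-∀)
open import Data.Product.Base using (_×_; _,_; proj₁; proj₂; ∃-syntax)
open import Data.Product.Properties using (≡-dec)
open import Data.Rational.Base using (ℚ; mkℚ; 0ℚ; 1ℚ; _+_; _*_; _-_; -_; _/_; _<_; _≤_; Positive; NonNegative; nonNegative; floor; toℚᵘ)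
import Data.Rational.Properties as ℚ
import Data.Rational.Solver as ℚ
open import Data.Rational.Unnormalised.Base as ℚᵘ using (mkℚᵘ; *≡*; *≤*)
import Data.Rational.Unnormalised.Properties as ℚᵘ
open import Data.Unit.Base using (⊤; tt)
open import Data.Vec.Base as Vec using (Vec; []; _∷_; lookup; zip)
open import Data.Vec.Relation.Unary.All as VecAll using ([]; _∷_)
import Data.Vec.Relation.Unary.All.Properties as VecAll
open import Function.Bundles using (Equivalence)
open import Relation.Binary.Definitions using (DecidableEquality)
open import Relation.Binary.PropositionalEquality using (_≡_; refl; sym; trans; cong; cong₂; subst)
open import Relation.Nullary.Decidable.Core using (yes; no; does)

-- Amortised cost of stateful programs

-- Φ is the potential of the amortised analysis; Ψ is a second quantity whose
-- growth is bounded independently of the time.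
module Amortised {St : Set} (Inv : St → Set) (Φ Ψ : St → ℕ) where

  record Outcome {A : Set} (Q : A → Set) (t e : ℕ) (s : St) (r : Timed (A × St)) : Set where
    constructor outcome
    private s′ = proj₂ (result r)
    field
      holds     : Q (proj₁ (result r))
      invariant : Inv s′
      cost      : time r ℕ.+ Φ s′ ℕ.≤ t ℕ.+ Φ s
      growth    : Ψ s′ ℕ.≤ e ℕ.+ Ψ s

  -- A record and not a function type, so that `p`, `Q`, `t` and `e` can be inferred when bounds are
  -- composed.
  record Bounded {A : Set} (p : Prog St A) (Q : A → Set) (t e : ℕ) : Set where
    field
      outcomeAt : ∀ s → Inv s → Outcome Q t e s (p s)

  open Bounded public

  Any : {A : Set} → A → Set
  Any _ = ⊤

  charge-bounded : ∀ c → Bounded (charge c) Any c 0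
  charge-bounded c .outcomeAt s i = outcome tt i ℕ.≤-refl ℕ.≤-refl

  call-bounded : ∀ {A : Set} {Q : A → Set} {r : Timed A} {t} →
                 Q (result r) → time r ℕ.≤ t → Bounded (call r) Q t 0
  call-bounded q r≤t .outcomeAt s i = outcome q i (ℕ.+-monoˡ-≤ (Φ s) r≤t) ℕ.≤-refl

  weaken : ∀ {A : Set} {p : Prog St A} {Q t t′ e e′} → t ℕ.≤ t′ → e ℕ.≤ e′ →
           Bounded p Q t e → Bounded p Q t′ e′
  weaken t≤t′ e≤e′ b .outcomeAt s i with outcomeAt b s i
  ... | outcome q i′ c g =
    outcome q i′ (ℕ.≤-trans c (ℕ.+-monoˡ-≤ (Φ s) t≤t′)) (ℕ.≤-trans g (ℕ.+-monoˡ-≤ (Ψ s) e≤e′))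

  private
    -- The intermediate potential `φ₁` cancels. With both times zero, the same inequality adds up
    -- the growth of `Ψ`.
    chainCost : ∀ c₁ c₂ φ φ₁ φ₂ t₁ t₂ → c₁ ℕ.+ φ₁ ℕ.≤ t₁ ℕ.+ φ → c₂ ℕ.+ φ₂ ℕ.≤ t₂ ℕ.+ φ₁ →
                c₁ ℕ.+ c₂ ℕ.+ φ₂ ℕ.≤ t₁ ℕ.+ t₂ ℕ.+ φ
    chainCost c₁ c₂ φ φ₁ φ₂ t₁ t₂ le₁ le₂ = begin
      c₁ ℕ.+ c₂ ℕ.+ φ₂     ≡⟨ ℕ.+-assoc c₁ c₂ φ₂ ⟩
      c₁ ℕ.+ (c₂ ℕ.+ φ₂)   ≤⟨ ℕ.+-monoʳ-≤ c₁ le₂ ⟩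
      c₁ ℕ.+ (t₂ ℕ.+ φ₁)   ≡⟨ swap c₁ t₂ φ₁ ⟩
      t₂ ℕ.+ (c₁ ℕ.+ φ₁)   ≤⟨ ℕ.+-monoʳ-≤ t₂ le₁ ⟩
      t₂ ℕ.+ (t₁ ℕ.+ φ)    ≡⟨ swap′ t₂ t₁ φ ⟩
      t₁ ℕ.+ t₂ ℕ.+ φ      ∎
      where
      open ℕ.≤-Reasoning
      swap : ∀ a b z → a ℕ.+ (b ℕ.+ z) ≡ b ℕ.+ (a ℕ.+ z)
      swap = solve-∀
      swap′ : ∀ a b z → a ℕ.+ (b ℕ.+ z) ≡ b ℕ.+ a ℕ.+ z
      swap′ = solve-∀

  infixl 1 _>>=ᵇ_ _>>ᵇ_

  -- The continuation may rely on `Q`; in this way the size of a decoded list bounds the number of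
  -- iterations of the loop over it.
  _>>=ᵇ_ : ∀ {A B : Set} {p : Prog St A} {f : A → Prog St B} {Q R t t′ e e′} →
           Bounded p Q t e → (∀ {a} → Q a → Bounded (f a) R t′ e′) →
           Bounded (p >>= f) R (t ℕ.+ t′) (e ℕ.+ e′)
  (_>>=ᵇ_ {p = p} {f} {t = t} {t′} {e} {e′} bp bf) .outcomeAt s i
    with p s | outcomeAt bp s i
  ... | c₁ , a , s₁ | outcome q i₁ cost₁ growth₁
    with f a s₁ | outcomeAt (bf q) s₁ i₁
  ... | c₂ , b , s₂ | outcome r i₂ cost₂ growth₂ =
    outcome r i₂ (chainCost c₁ c₂ (Φ s) (Φ s₁) (Φ s₂) t t′ cost₁ cost₂)
                 (chainCost 0 0 (Ψ s) (Ψ s₁) (Ψ s₂) e e′ growth₁ growth₂)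

  _>>ᵇ_ : ∀ {A B : Set} {p : Prog St A} {q : Prog St B} {Q R t t′ e e′} →
          Bounded p Q t e → Bounded q R t′ e′ → Bounded (p >> q) R (t ℕ.+ t′) (e ℕ.+ e′)
  bp >>ᵇ bq = bp >>=ᵇ λ _ → bq

  forEach-bounded : ∀ {A : Set} {body : A → Prog St ⊤} {t e} (xs : List A) →
                    (∀ x → Bounded (body x) Any t e) →
                    Bounded (forEach xs body) Any (length xs ℕ.* (1 ℕ.+ t) ℕ.+ 1) (length xs ℕ.* e)
  forEach-bounded []       b = charge-bounded 1
  forEach-bounded {t = t} {e} (x ∷ xs) b =
    weaken (ℕ.≤-reflexive (reassoc t (length xs ℕ.* (1 ℕ.+ t)))) ℕ.≤-refl
      (charge-bounded 1 >>ᵇ (b x >>ᵇ forEach-bounded xs b))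
    where
    reassoc : ∀ t l → 1 ℕ.+ (t ℕ.+ (l ℕ.+ 1)) ≡ 1 ℕ.+ t ℕ.+ l ℕ.+ 1
    reassoc = solve-∀

  -- Bounds of the form c * z, z compose along nested loops: each level only adds
  -- 2 to c, which pays for the loop tests.
  loop-bounded : ∀ {A : Set} {body : A → Prog St ⊤} c {z} m .{{_ : NonZero m}} .{{_ : NonZero z}}
                 (xs : List A) → length xs ℕ.≤ m →
                 (∀ x → Bounded (body x) Any (c ℕ.* z) z) →
                 Bounded (forEach xs body) Any ((2 ℕ.+ c) ℕ.* (m ℕ.* z)) (m ℕ.* z)
  loop-bounded c {z} m xs l≤m b =
    weaken steps (ℕ.*-monoˡ-≤ z l≤m) (forEach-bounded xs b)
    where
    open ℕ.≤-Reasoning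
    expand : ∀ m c z → m ℕ.* (1 ℕ.+ c ℕ.* z) ≡ m ℕ.+ c ℕ.* (m ℕ.* z)
    expand = solve-∀
    collect : ∀ c y → y ℕ.+ c ℕ.* y ℕ.+ y ≡ (2 ℕ.+ c) ℕ.* y
    collect = solve-∀
    steps : length xs ℕ.* (1 ℕ.+ c ℕ.* z) ℕ.+ 1 ℕ.≤ (2 ℕ.+ c) ℕ.* (m ℕ.* z)
    steps = begin
      length xs ℕ.* (1 ℕ.+ c ℕ.* z) ℕ.+ 1           ≤⟨ ℕ.+-monoˡ-≤ 1 (ℕ.*-monoˡ-≤ (1 ℕ.+ c ℕ.* z) l≤m) ⟩
      m ℕ.* (1 ℕ.+ c ℕ.* z) ℕ.+ 1                   ≡⟨ cong (ℕ._+ 1) (expand m c z) ⟩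
      -- The `m` successful loop tests and the final one fit into one copy of `m * z` each, since
      -- neither factor is zero.
      m ℕ.+ c ℕ.* (m ℕ.* z) ℕ.+ 1                   ≤⟨ ℕ.+-mono-≤ (ℕ.+-monoˡ-≤ _ (ℕ.m≤m*n m z)) (ℕ.>-nonZero⁻¹ (m ℕ.* z)) ⟩
      m ℕ.* z ℕ.+ c ℕ.* (m ℕ.* z) ℕ.+ m ℕ.* z       ≡⟨ collect c (m ℕ.* z) ⟩
      (2 ℕ.+ c) ℕ.* (m ℕ.* z)                       ∎

-- Sizes of blocks, windows and edge sets

length-block : ∀ {A : Set} N k (xs : List A) → length (block N k xs) ℕ.≤ N
length-block N k xs =
  ℕ.≤-trans (ℕ.≤-reflexive (length-take N (drop (k ℕ.* N) xs))) (ℕ.m⊓n≤m N _)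

length-window : ∀ w j → length (window w j) ℕ.≤ 1 ℕ.+ 2 ℕ.* ℤ.∣ floor w ∣
length-window w j = begin
  length (window w j)                 ≡⟨ length-map ((j ∸ f) ℕ.+_) (upTo size) ⟩
  length (upTo size)                  ≡⟨ length-upTo size ⟩
  -- `j ≤ f + (j ∸ f)` holds even where the subtraction is cut off at 0, so windows near 0 need no
  -- separate case.
  suc (j ℕ.+ f) ∸ (j ∸ f)             ≤⟨ ℕ.∸-monoˡ-≤ (j ∸ f) (s≤s (ℕ.+-monoˡ-≤ f (ℕ.m≤n+m∸n j f))) ⟩
  suc (f ℕ.+ (j ∸ f) ℕ.+ f) ∸ (j ∸ f) ≡⟨ cong (_∸ (j ∸ f)) (regroup f (j ∸ f)) ⟩
  1 ℕ.+ 2 ℕ.* f ℕ.+ (j ∸ f) ∸ (j ∸ f) ≡⟨ ℕ.m+n∸n≡m (1 ℕ.+ 2 ℕ.* f) (j ∸ f) ⟩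
  1 ℕ.+ 2 ℕ.* f                       ∎
  where
  open ℕ.≤-Reasoning
  f    = ℤ.∣ floor w ∣
  size = suc (j ℕ.+ f) ∸ (j ∸ f)
  regroup : ∀ f d → suc (f ℕ.+ d ℕ.+ f) ≡ 1 ℕ.+ 2 ℕ.* f ℕ.+ d
  regroup = solve-∀

edgeCount-connect : ∀ {p q} (e : Edge p q) G →
  BipartiteGraph.edgeCount (connect e G) ℕ.≤ 1 ℕ.+ BipartiteGraph.edgeCount G
edgeCount-connect e (graph es u) with DecMembership._∈?_ (≡-dec Fin._≟_ Fin._≟_) e es
... | yes _ = ℕ.n≤1+n _
... | no  _ = ℕ.≤-refl

-- Unknown entries of the memo table

unknowns : ∀ {A : Set} {n} → Vec (Maybe A) n → ℕ
unknowns []             = 0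
unknowns (just _  ∷ xs) = unknowns xs
unknowns (nothing ∷ xs) = suc (unknowns xs)

unknowns-replicate : ∀ {A : Set} n → unknowns (Vec.replicate n (nothing {A = A})) ≡ n
unknowns-replicate zero    = refl
unknowns-replicate (suc n) = cong suc (unknowns-replicate n)

-- This pays for a miss: filling the entry releases the potential of exactly one call.
unknowns-update : ∀ {A : Set} {n} (xs : Vec (Maybe A) n) i a → lookup xs i ≡ nothing →
                  unknowns xs ≡ suc (unknowns (xs Vec.[ i ]≔ just a))
unknowns-update (nothing ∷ xs) zero    a eq = refl
unknowns-update (just _  ∷ xs) (suc i) a eq = unknowns-update xs i a eq
unknowns-update (nothing ∷ xs) (suc i) a eq = cong suc (unknowns-update xs i a eq)

All-update : ∀ {A : Set} {P : A → Set} {n} {xs : Vec A n} i {a} →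
             VecAll.All P xs → P a → VecAll.All P (xs Vec.[ i ]≔ a)
All-update zero    (_  ∷ pxs) pa = pa ∷ pxs
All-update (suc i) (px ∷ pxs) pa = px ∷ All-update i pxs pa

All-replicate : ∀ {A : Set} {P : A → Set} n {a} → P a → VecAll.All P (Vec.replicate n a)
All-replicate zero    pa = []
All-replicate (suc n) pa = pa ∷ All-replicate n pa

-- Counting blocks, sub-blocks and innermost iterations

module BlockArithmetic
  {p q n B X N₁ N₂ L₁ L₂ W : ℕ}
  .{{_ : NonZero N₁}} .{{_ : NonZero N₂}} .{{_ : NonZero L₁}} .{{_ : NonZero L₂}} .{{_ : NonZero W}}
  (p≤n : p ℕ.≤ n) (q≤n : q ℕ.≤ n) (N₁≤n : N₁ ℕ.≤ n)
  (B*N₁≤ : B ℕ.* N₁ ℕ.≤ q ℕ.+ (N₁ ∸ 1)) (X*N₂≤N₁ : X ℕ.* N₂ ℕ.≤ N₁)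
  where

  -- Z bounds the innermost iterations for one block S′(i).
  Y Z : ℕ
  Y = N₂ ℕ.* L₁ ℕ.* L₂ ℕ.* (W ℕ.* W)
  Z = L₁ ℕ.* (W ℕ.* (X ℕ.* (L₂ ℕ.* (W ℕ.* (N₂ ℕ.* (N₂ ℕ.* 1))))))

  open ℕ.≤-Reasoning

  -- Rounding the number of blocks up adds at most `N₁ ∸ 1` positions, hence no more than another
  -- `n`.
  B*N₁≤2n : B ℕ.* N₁ ℕ.≤ 2 ℕ.* n
  B*N₁≤2n = begin
    B ℕ.* N₁          ≤⟨ B*N₁≤ ⟩
    q ℕ.+ (N₁ ∸ 1)    ≤⟨ ℕ.+-mono-≤ q≤n (ℕ.≤-trans (ℕ.m∸n≤m N₁ 1) N₁≤n) ⟩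
    n ℕ.+ n           ≡⟨ cong (n ℕ.+_) (ℕ.+-identityʳ n) ⟨
    2 ℕ.* n           ∎

  X*N₂≤n : X ℕ.* N₂ ℕ.≤ n
  X*N₂≤n = ℕ.≤-trans X*N₂≤N₁ N₁≤n

  B*XN₂≤2n : B ℕ.* (X ℕ.* N₂) ℕ.≤ 2 ℕ.* n
  B*XN₂≤2n = ℕ.≤-trans (ℕ.*-monoʳ-≤ B X*N₂≤N₁) B*N₁≤2n

  -- Counts the table entries that can become known: `X` after each of the `B` resets, and another
  -- `X` for the initial table, whose unknown entries enter the initial potential.
  [1+B]X*N₂≤3n : suc B ℕ.* X ℕ.* N₂ ℕ.≤ 3 ℕ.* n
  [1+B]X*N₂≤3n = begin
    suc B ℕ.* X ℕ.* N₂                  ≡⟨ ℕ.*-assoc (suc B) X N₂ ⟩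
    X ℕ.* N₂ ℕ.+ B ℕ.* (X ℕ.* N₂)       ≤⟨ ℕ.+-mono-≤ X*N₂≤n B*XN₂≤2n ⟩
    3 ℕ.* n                             ∎

  -- One of the two factors `N₂` of `Z` joins `B * X`, where it is absorbed into `2 * n`; the other
  -- stays in `Y`.
  edges≤ : B ℕ.* Z ℕ.≤ 2 ℕ.* (n ℕ.* Y)
  edges≤ = begin
    B ℕ.* Z                       ≡⟨ regroup B L₁ W X L₂ N₂ ⟩
    B ℕ.* (X ℕ.* N₂) ℕ.* Y        ≤⟨ ℕ.*-monoˡ-≤ Y B*XN₂≤2n ⟩
    2 ℕ.* n ℕ.* Y                 ≡⟨ ℕ.*-assoc 2 n Y ⟩
    2 ℕ.* (n ℕ.* Y)               ∎
    where
    regroup : ∀ B L₁ W X L₂ N₂ →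
      B ℕ.* (L₁ ℕ.* (W ℕ.* (X ℕ.* (L₂ ℕ.* (W ℕ.* (N₂ ℕ.* (N₂ ℕ.* 1)))))))
      ≡ B ℕ.* (X ℕ.* N₂) ℕ.* (N₂ ℕ.* L₁ ℕ.* L₂ ℕ.* (W ℕ.* W))
    regroup = solve-∀

  n≤nY : n ℕ.≤ n ℕ.* Y
  n≤nY = ℕ.m≤m*n n Y {{ℕ.m*n≢0 _ _ {{ℕ.m*n≢0 _ _ {{ℕ.m*n≢0 N₂ L₁}}}} {{ℕ.m*n≢0 W W}}}}

  -- The 3 consists of one `n * Y` for the vertices and two for the edges.
  matching≤ : ∀ C ll {e} → e ℕ.≤ B ℕ.* Z → C ℕ.* ((n ℕ.+ e) ℕ.* ll) ℕ.≤ 3 ℕ.* C ℕ.* (n ℕ.* Y ℕ.* ll)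
  matching≤ C ll {e} e≤ = begin
    C ℕ.* ((n ℕ.+ e) ℕ.* ll)
      ≤⟨ ℕ.*-monoʳ-≤ C (ℕ.*-monoˡ-≤ ll (ℕ.+-mono-≤ n≤nY (ℕ.≤-trans e≤ edges≤))) ⟩
    C ℕ.* (3 ℕ.* (n ℕ.* Y) ℕ.* ll)
      ≡⟨ regroup C (n ℕ.* Y) ll ⟩
    3 ℕ.* C ℕ.* (n ℕ.* Y ℕ.* ll) ∎
    where
    regroup : ∀ C y l → C ℕ.* (3 ℕ.* y ℕ.* l) ≡ 3 ℕ.* C ℕ.* (y ℕ.* l)
    regroup = solve-∀

  -- The decoding times are kept as they are; all other steps become multiples of `n * Y`. The 49 is
  -- 15, from terms linear in `n`, plus 17 * 2 from the nested loops.
  building≤ : ∀ τ₁ τ₂ →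
              p ℕ.+ q ℕ.+ (B ℕ.* (1 ℕ.+ (X ℕ.+ (N₂ ℕ.+ τ₂ ℕ.+ 1) ℕ.* X ℕ.+ (N₁ ℕ.+ τ₁ ℕ.+ 17 ℕ.* Z)))
                ℕ.+ 1 ℕ.+ (N₂ ℕ.+ τ₂ ℕ.+ 1) ℕ.* X)
              ℕ.≤ B ℕ.* τ₁ ℕ.+ suc B ℕ.* X ℕ.* τ₂ ℕ.+ 49 ℕ.* (n ℕ.* Y)
  building≤ τ₁ τ₂ = begin
    p ℕ.+ q ℕ.+ (B ℕ.* (1 ℕ.+ (X ℕ.+ (N₂ ℕ.+ τ₂ ℕ.+ 1) ℕ.* X ℕ.+ (N₁ ℕ.+ τ₁ ℕ.+ 17 ℕ.* Z)))
      ℕ.+ 1 ℕ.+ (N₂ ℕ.+ τ₂ ℕ.+ 1) ℕ.* X)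
      ≡⟨ regroup p q B X N₁ N₂ τ₁ τ₂ Z ⟩
    dec ℕ.+ (p ℕ.+ q ℕ.+ 1 ℕ.+ X ℕ.+ X ℕ.* N₂
      ℕ.+ (B ℕ.+ B ℕ.* N₁ ℕ.+ 2 ℕ.* (B ℕ.* X) ℕ.+ B ℕ.* (X ℕ.* N₂)) ℕ.+ 17 ℕ.* (B ℕ.* Z))
      ≤⟨ ℕ.+-monoʳ-≤ dec (
         (p≤n ⊕ q≤n ⊕ ℕ.≤-trans (ℕ.>-nonZero⁻¹ N₁) N₁≤n
           ⊕ ℕ.≤-trans (ℕ.m≤m*n X N₂) X*N₂≤n ⊕ X*N₂≤n
           ⊕ (ℕ.≤-trans (ℕ.m≤m*n B N₁) B*N₁≤2n ⊕ B*N₁≤2n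
             ⊕ ℕ.*-monoʳ-≤ 2 (ℕ.≤-trans (ℕ.*-monoʳ-≤ B (ℕ.m≤m*n X N₂)) B*XN₂≤2n) ⊕ B*XN₂≤2n))
           ⊕ ℕ.*-monoʳ-≤ 17 edges≤) ⟩
    dec ℕ.+ (n ℕ.+ n ℕ.+ n ℕ.+ n ℕ.+ n
      ℕ.+ (2 ℕ.* n ℕ.+ 2 ℕ.* n ℕ.+ 2 ℕ.* (2 ℕ.* n) ℕ.+ 2 ℕ.* n) ℕ.+ 17 ℕ.* (2 ℕ.* (n ℕ.* Y)))
      ≡⟨ cong (dec ℕ.+_) (collect n (n ℕ.* Y)) ⟩
    dec ℕ.+ (15 ℕ.* n ℕ.+ 34 ℕ.* (n ℕ.* Y))
      ≤⟨ ℕ.+-monoʳ-≤ dec (ℕ.+-monoˡ-≤ (34 ℕ.* (n ℕ.* Y)) (ℕ.*-monoʳ-≤ 15 n≤nY)) ⟩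
    dec ℕ.+ (15 ℕ.* (n ℕ.* Y) ℕ.+ 34 ℕ.* (n ℕ.* Y))
      ≡⟨ cong (dec ℕ.+_) (ℕ.*-distribʳ-+ (n ℕ.* Y) 15 34) ⟨
    dec ℕ.+ 49 ℕ.* (n ℕ.* Y) ∎
    where
    dec = B ℕ.* τ₁ ℕ.+ suc B ℕ.* X ℕ.* τ₂
    infixl 6 _⊕_
    _⊕_ = ℕ.+-mono-≤
    regroup : ∀ p q B X N₁ N₂ τ₁ τ₂ Z →
      p ℕ.+ q ℕ.+ (B ℕ.* (1 ℕ.+ (X ℕ.+ (N₂ ℕ.+ τ₂ ℕ.+ 1) ℕ.* X ℕ.+ (N₁ ℕ.+ τ₁ ℕ.+ 17 ℕ.* Z)))
        ℕ.+ 1 ℕ.+ (N₂ ℕ.+ τ₂ ℕ.+ 1) ℕ.* X)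
      ≡ B ℕ.* τ₁ ℕ.+ suc B ℕ.* X ℕ.* τ₂ ℕ.+ (p ℕ.+ q ℕ.+ 1 ℕ.+ X ℕ.+ X ℕ.* N₂
        ℕ.+ (B ℕ.+ B ℕ.* N₁ ℕ.+ 2 ℕ.* (B ℕ.* X) ℕ.+ B ℕ.* (X ℕ.* N₂)) ℕ.+ 17 ℕ.* (B ℕ.* Z))
    regroup = solve-∀
    collect : ∀ n y → n ℕ.+ n ℕ.+ n ℕ.+ n ℕ.+ n
      ℕ.+ (2 ℕ.* n ℕ.+ 2 ℕ.* n ℕ.+ 2 ℕ.* (2 ℕ.* n) ℕ.+ 2 ℕ.* n) ℕ.+ 17 ℕ.* (2 ℕ.* y)
      ≡ 15 ℕ.* n ℕ.+ 34 ℕ.* y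
    collect = solve-∀

-- Running time of the algorithm

module Analysis
  {Γ : Set} (_≟Γ_ : DecidableEquality Γ)
  {a₁ a₂ M₁ M₂ p q : ℕ}
  (HS : HuntSzymanski)
  (ε : ℚ) .{{_ : Positive ε}}
  (S : Vec (Symbol Γ a₁ a₂) p) (S′ : Vec (Symbol Γ a₁ a₂) q)
  (N₁ N₂ : ℕ) .{{_ : NonZero N₁}} .{{_ : NonZero N₂}}
  (dec₁ : List (Fin a₁) → Timed (List (Fin M₁)))
  (dec₂ : List (Fin a₂) → Timed (List (Fin M₂)))
  (L₁ L₂ W τ₁ τ₂ : ℕ)
  .{{_ : NonZero L₁}} .{{_ : NonZero L₂}} .{{_ : NonZero W}} .{{_ : NonZero (N₁ ℕ./ N₂)}}
  (listSize₁ : ∀ y → length (result (dec₁ y)) ℕ.≤ L₁)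
  (listSize₂ : ∀ y → length (result (dec₂ y)) ℕ.≤ L₂)
  (decodeTime₁ : ∀ y → length y ℕ.≤ N₁ → time (dec₁ y) ℕ.≤ τ₁)
  (decodeTime₂ : ∀ y → length y ℕ.≤ N₂ → time (dec₂ y) ℕ.≤ τ₂)
  (windowSize : ∀ j → length (window (recip ε) j) ℕ.≤ W)
  where

  open EnhancedEDApprox _≟Γ_ HS ε S S′ N₁ N₂ dec₁ dec₂ public
  open Store

  X B missCost : ℕ
  X = N₁ ℕ./ N₂
  B = blockCount N₁ q
  missCost = N₂ ℕ.+ τ₂ ℕ.+ 1

  -- Lists found in the table must obey the same size bound as freshly decoded ones; this invariant
  -- supplies it on a hit.
  Valid : Store → Set
  Valid s = VecAll.All (Maybe.All (λ l → length l ℕ.≤ L₂)) (memo s)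

  -- Each entry of the table that is still unknown prepays one call of dec₂.
  Φ Ψ : Store → ℕ
  Φ s = missCost ℕ.* unknowns (memo s)
  Ψ s = BipartiteGraph.edgeCount (G s)

  open Amortised Valid Φ Ψ

  -- Besides clearing the table, a reset pays for a full potential of `missCost * X`; what remains
  -- of the old one is given up.
  resetMemo-bounded : Bounded resetMemo Any (X ℕ.+ missCost ℕ.* X) 0
  resetMemo-bounded = charge-bounded X >>ᵇ reset
    where
    reset : Bounded (modify λ s → record s { memo = emptyMemo }) Any (missCost ℕ.* X) 0
    reset .outcomeAt s i = outcome tt (All-replicate X Maybe.nothing)
      (ℕ.≤-trans (ℕ.≤-reflexive (cong (missCost ℕ.*_) (unknowns-replicate X))) (ℕ.m≤m+n _ (Φ s)))
      ℕ.≤-refl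

  length-C′ : ∀ i → length (C′ i) ℕ.≤ N₁
  length-C′ i = ℕ.≤-trans (ℕ.≤-reflexive (length-map _ (blockS′ i))) (length-block N₁ i (allFin q))

  length-C″ : ∀ i i′ → length (C″ i i′) ℕ.≤ N₂
  length-C″ i i′ =
    ℕ.≤-trans (ℕ.≤-reflexive (length-map _ (subBlockS′ i i′))) (length-block N₂ i′ (blockS′ i))

  list₁-bounded : ∀ i → Bounded (list₁ i) (λ l → length l ℕ.≤ L₁) (N₁ ℕ.+ τ₁) 0
  list₁-bounded i =
    weaken (ℕ.+-monoˡ-≤ τ₁ (length-C′ i)) ℕ.≤-refl
      (charge-bounded (length (C′ i)) >>ᵇ
       call-bounded (listSize₁ (C′ i)) (decodeTime₁ (C′ i) (length-C′ i)))

  -- The amortised cost of 1 is the table lookup. On a miss the remaining steps, at most `missCost`,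
  -- are paid by the entry being filled.
  list₂-bounded : ∀ i i′ → Bounded (list₂ i i′) (λ l → length l ℕ.≤ L₂) 1 0
  list₂-bounded i i′ .outcomeAt s valid
    with lookup (memo s) i′ in eq | VecAll.lookup⁺ valid i′
  ... | just l  | Maybe.just l≤ = outcome l≤ valid ℕ.≤-refl ℕ.≤-refl
  ... | nothing | _ =
    outcome (listSize₂ y) (All-update i′ valid (Maybe.just (listSize₂ y))) steps ℕ.≤-refl
    where
    open ℕ.≤-Reasoning
    y = C″ i (toℕ i′)
    l = result (dec₂ y)
    rest = unknowns (memo s Vec.[ i′ ]≔ just l)
    regroup : ∀ a b c → suc (a ℕ.+ (b ℕ.+ 1)) ℕ.+ c ≡ suc (a ℕ.+ b ℕ.+ 1 ℕ.+ c)
    regroup = solve-∀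
    steps : suc (length y ℕ.+ (time (dec₂ y) ℕ.+ 1)) ℕ.+ missCost ℕ.* rest ℕ.≤ suc (missCost ℕ.* unknowns (memo s))
    steps = begin
      suc (length y ℕ.+ (time (dec₂ y) ℕ.+ 1)) ℕ.+ missCost ℕ.* rest
        ≡⟨ regroup (length y) (time (dec₂ y)) (missCost ℕ.* rest) ⟩
      suc (length y ℕ.+ time (dec₂ y) ℕ.+ 1 ℕ.+ missCost ℕ.* rest)
        ≤⟨ s≤s (ℕ.+-monoˡ-≤ (missCost ℕ.* rest) (ℕ.+-monoˡ-≤ 1
             (ℕ.+-mono-≤ (length-C″ i (toℕ i′)) (decodeTime₂ y (length-C″ i (toℕ i′)))))) ⟩
      suc (missCost ℕ.+ missCost ℕ.* rest)
        ≡⟨ cong suc (ℕ.*-suc missCost rest) ⟨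
      suc (missCost ℕ.* suc rest)
        ≡⟨ cong (λ u → suc (missCost ℕ.* u)) (unknowns-update (memo s) i′ l eq) ⟨
      suc (missCost ℕ.* unknowns (memo s)) ∎

  connectIfIdentical-bounded : ∀ u v → Bounded (connectIfIdentical u v) Any 2 1
  connectIfIdentical-bounded u v .outcomeAt s i with does (lookup S u ≟ lookup S′ v)
  ... | true  = outcome tt i ℕ.≤-refl (edgeCount-connect (u , v) (G s))
  ... | false = outcome tt i (ℕ.n≤1+n _) (ℕ.n≤1+n _)

  -- The nesting, with its trailing `* 1`, is the form in which `loop-bounded` builds up from one
  -- edge per innermost iteration.
  perSubBlock perBlock : ℕ
  perSubBlock = L₂ ℕ.* (W ℕ.* (N₂ ℕ.* (N₂ ℕ.* 1)))
  perBlock = L₁ ℕ.* (W ℕ.* (X ℕ.* perSubBlock))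

  blockCost : ℕ
  blockCost = X ℕ.+ missCost ℕ.* X ℕ.+ (N₁ ℕ.+ τ₁ ℕ.+ 17 ℕ.* perBlock)

  buildGraph-bounded :
    Bounded buildGraph Any (B ℕ.* (1 ℕ.+ blockCost) ℕ.+ 1) (B ℕ.* perBlock)
  buildGraph-bounded =
    subst (λ b → Bounded buildGraph Any (b ℕ.* (1 ℕ.+ blockCost) ℕ.+ 1) (b ℕ.* perBlock))
      (length-upTo B)
      (forEach-bounded (upTo B) λ i →
        resetMemo-bounded >>ᵇ (list₁-bounded i >>=ᵇ λ {l₁} l₁≤ →
          -- Read from the inside, the constants start at 2 for one comparison and one update and
          -- grow by 2 per loop. The table lookup raises 10 to 11, and this loop ends at the 17 of
          -- `blockCost`.
          loop-bounded 15 L₁ l₁ l₁≤ λ j →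
          loop-bounded 13 W (window w (toℕ j)) (windowSize (toℕ j)) λ k →
          loop-bounded 11 X (allFin X) (ℕ.≤-reflexive (length-tabulate λ i′ → i′)) λ i′ →
          weaken (ℕ.+-monoˡ-≤ _ (ℕ.>-nonZero⁻¹ perSubBlock)) ℕ.≤-refl (
          list₂-bounded i i′ >>=ᵇ λ {l₂} l₂≤ →
          loop-bounded 8 L₂ l₂ l₂≤ λ j′ →
          loop-bounded 6 W (window w (toℕ j′)) (windowSize (toℕ j′)) λ k′ →
          loop-bounded 4 N₂ (subBlockS k k′) (length-block N₂ k′ (block N₁ k (allFin p))) λ u →
          loop-bounded 2 N₂ (subBlockS′ i (toℕ i′)) (length-block N₂ (toℕ i′) (blockS′ i)) λ v →
          connectIfIdentical-bounded u v)))

  n Y ll C : ℕ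
  n  = p ⊔ q
  Y  = N₂ ℕ.* L₁ ℕ.* L₂ ℕ.* (W ℕ.* W)
  ll = loglog n
  C  = HuntSzymanski.constant HS

  module _ (N₁≤n : N₁ ℕ.≤ n) .{{_ : NonZero ll}} (large : HuntSzymanski.threshold HS ℕ.≤ n) where

    open ℕ.≤-Reasoning

    open BlockArithmetic {B = B} {X} {N₁} {N₂} {L₁ = L₁} {L₂ = L₂} {W = W}
      (ℕ.m≤m⊔n p q) (ℕ.m≤n⊔m p q) N₁≤n (m/n*n≤m (q ℕ.+ (N₁ ∸ 1)) N₁) (m/n*n≤m N₁ N₂)
      using (B*N₁≤2n; [1+B]X*N₂≤3n; matching≤; building≤) public

    time-run : time run ℕ.≤ B ℕ.* τ₁ ℕ.+ suc B ℕ.* X ℕ.* τ₂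
                            ℕ.+ (49 ℕ.+ 3 ℕ.* C) ℕ.* (n ℕ.* Y ℕ.* ll)
    time-run = begin
      time run
        ≡⟨ ℕ.+-assoc (p ℕ.+ q) (time built) (time matched) ⟨
      p ℕ.+ q ℕ.+ time built ℕ.+ time matched
        ≤⟨ ℕ.+-mono-≤ (ℕ.+-monoʳ-≤ (p ℕ.+ q) built≤) matched≤ ⟩
      p ℕ.+ q ℕ.+ (B ℕ.* (1 ℕ.+ blockCost) ℕ.+ 1 ℕ.+ missCost ℕ.* X) ℕ.+ 3 ℕ.* C ℕ.* (n ℕ.* Y ℕ.* ll)
        -- Since `ll` is at least 1, the building steps can be given the factor `ll` of the
        -- matching.
        ≤⟨ ℕ.+-monoˡ-≤ (3 ℕ.* C ℕ.* (n ℕ.* Y ℕ.* ll)) (ℕ.≤-trans (building≤ τ₁ τ₂)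
             (ℕ.+-monoʳ-≤ dec (ℕ.*-monoʳ-≤ 49 (ℕ.m≤m*n (n ℕ.* Y) ll)))) ⟩
      dec ℕ.+ 49 ℕ.* (n ℕ.* Y ℕ.* ll) ℕ.+ 3 ℕ.* C ℕ.* (n ℕ.* Y ℕ.* ll)
        ≡⟨ ℕ.+-assoc dec (49 ℕ.* (n ℕ.* Y ℕ.* ll)) (3 ℕ.* C ℕ.* (n ℕ.* Y ℕ.* ll)) ⟩
      dec ℕ.+ (49 ℕ.* (n ℕ.* Y ℕ.* ll) ℕ.+ 3 ℕ.* C ℕ.* (n ℕ.* Y ℕ.* ll))
        ≡⟨ cong (dec ℕ.+_) (ℕ.*-distribʳ-+ (n ℕ.* Y ℕ.* ll) 49 (3 ℕ.* C)) ⟨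
      dec ℕ.+ (49 ℕ.+ 3 ℕ.* C) ℕ.* (n ℕ.* Y ℕ.* ll) ∎
      where
      dec = B ℕ.* τ₁ ℕ.+ suc B ℕ.* X ℕ.* τ₂
      initial = store emptyGraph emptyMemo
      built = buildGraph initial
      final = proj₂ (result built)
      matched = HuntSzymanski.match HS (G final)
      built-outcome : Outcome Any (B ℕ.* (1 ℕ.+ blockCost) ℕ.+ 1) (B ℕ.* perBlock) initial built
      built-outcome = outcomeAt buildGraph-bounded initial (All-replicate X Maybe.nothing)
      open Outcome built-outcome
      built≤ : time built ℕ.≤ B ℕ.* (1 ℕ.+ blockCost) ℕ.+ 1 ℕ.+ missCost ℕ.* X
      built≤ = begin
        -- The final potential is dropped; the initial one, from `X` unknown entries, turns `B` into
        -- `suc B` in the second decoder's term.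
        time built                                                   ≤⟨ ℕ.m≤m+n (time built) (Φ final) ⟩
        time built ℕ.+ Φ final                                       ≤⟨ cost ⟩
        B ℕ.* (1 ℕ.+ blockCost) ℕ.+ 1 ℕ.+ missCost ℕ.* unknowns emptyMemo
          ≡⟨ cong (λ u → B ℕ.* (1 ℕ.+ blockCost) ℕ.+ 1 ℕ.+ missCost ℕ.* u) (unknowns-replicate X) ⟩
        B ℕ.* (1 ℕ.+ blockCost) ℕ.+ 1 ℕ.+ missCost ℕ.* X             ∎
      matched≤ : time matched ℕ.≤ 3 ℕ.* C ℕ.* (n ℕ.* Y ℕ.* ll)
      matched≤ = ℕ.≤-trans (HuntSzymanski.matchTime HS (G final) large)
        -- The initial graph has no edges, so `growth` bounds the edge count of the final graph
        -- itself.
        (matching≤ C ll (ℕ.≤-trans growth (ℕ.≤-reflexive (ℕ.+-identityʳ (B ℕ.* perBlock)))))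

-- Natural numbers inside the rationals

-- `⟦ n ⟧` is normalised by a gcd that does not compute for variable `n`; the facts below are
-- therefore checked on unnormalised fractions.
toℚᵘ-⟦⟧ : ∀ n → toℚᵘ ⟦ n ⟧ ℚᵘ.≃ mkℚᵘ (+ n) 0
toℚᵘ-⟦⟧ n = ℚ.toℚᵘ-fromℚᵘ (mkℚᵘ (+ n) 0)

⟦⟧-homo-+ : ∀ m n → ⟦ m ℕ.+ n ⟧ ≡ ⟦ m ⟧ + ⟦ n ⟧
⟦⟧-homo-+ m n = ℚ.toℚᵘ-injective (begin
  toℚᵘ ⟦ m ℕ.+ n ⟧                    ≈⟨ toℚᵘ-⟦⟧ (m ℕ.+ n) ⟩
  mkℚᵘ (+ (m ℕ.+ n)) 0                ≈⟨ *≡* (cong (ℤ._* + 1) (cong₂ ℤ._+_ (ℤ.*-identityʳ (+ m)) (ℤ.*-identityʳ (+ n)))) ⟨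
  mkℚᵘ (+ m) 0 ℚᵘ.+ mkℚᵘ (+ n) 0      ≈⟨ ℚᵘ.+-cong (toℚᵘ-⟦⟧ m) (toℚᵘ-⟦⟧ n) ⟨
  toℚᵘ ⟦ m ⟧ ℚᵘ.+ toℚᵘ ⟦ n ⟧          ≈⟨ ℚ.toℚᵘ-homo-+ ⟦ m ⟧ ⟦ n ⟧ ⟨
  toℚᵘ (⟦ m ⟧ + ⟦ n ⟧)                ∎)
  where open import Relation.Binary.Reasoning.Setoid ℚᵘ.≃-setoid

/-*-cancel : ∀ m n .{{_ : NonZero n}} → (+ m / n) * ⟦ n ⟧ ≡ ⟦ m ⟧
/-*-cancel m n@(suc d) = ℚ.toℚᵘ-injective (begin
  toℚᵘ ((+ m / n) * ⟦ n ⟧)            ≈⟨ ℚ.toℚᵘ-homo-* (+ m / n) ⟦ n ⟧ ⟩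
  toℚᵘ (+ m / n) ℚᵘ.* toℚᵘ ⟦ n ⟧      ≈⟨ ℚᵘ.*-cong (ℚ.toℚᵘ-fromℚᵘ (mkℚᵘ (+ m) d)) (toℚᵘ-⟦⟧ n) ⟩
  mkℚᵘ (+ m) d ℚᵘ.* mkℚᵘ (+ n) 0      ≈⟨ *≡* (ℤ.*-assoc (+ m) (+ n) (+ 1)) ⟩
  mkℚᵘ (+ m) 0                        ≈⟨ toℚᵘ-⟦⟧ m ⟨
  toℚᵘ ⟦ m ⟧                          ∎)
  where open import Relation.Binary.Reasoning.Setoid ℚᵘ.≃-setoid

⟦⟧-homo-* : ∀ m n → ⟦ m ℕ.* n ⟧ ≡ ⟦ m ⟧ * ⟦ n ⟧
⟦⟧-homo-* m n = ℚ.toℚᵘ-injective (begin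
  toℚᵘ ⟦ m ℕ.* n ⟧                    ≈⟨ toℚᵘ-⟦⟧ (m ℕ.* n) ⟩
  mkℚᵘ (+ (m ℕ.* n)) 0                ≈⟨ *≡* (cong (ℤ._* + 1) (ℤ.pos-* m n)) ⟩
  mkℚᵘ (+ m) 0 ℚᵘ.* mkℚᵘ (+ n) 0      ≈⟨ ℚᵘ.*-cong (toℚᵘ-⟦⟧ m) (toℚᵘ-⟦⟧ n) ⟨
  toℚᵘ ⟦ m ⟧ ℚᵘ.* toℚᵘ ⟦ n ⟧          ≈⟨ ℚ.toℚᵘ-homo-* ⟦ m ⟧ ⟦ n ⟧ ⟨
  toℚᵘ (⟦ m ⟧ * ⟦ n ⟧)                ∎)
  where open import Relation.Binary.Reasoning.Setoid ℚᵘ.≃-setoid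

⟦⟧-mono-≤ : ∀ {m n} → m ℕ.≤ n → ⟦ m ⟧ ≤ ⟦ n ⟧
⟦⟧-mono-≤ {m} {n} m≤n = ℚ.toℚᵘ-cancel-≤ (begin
  toℚᵘ ⟦ m ⟧    ≃⟨ toℚᵘ-⟦⟧ m ⟩
  mkℚᵘ (+ m) 0  ≤⟨ *≤* (ℤ.*-monoʳ-≤-nonNeg (+ 1) (ℤ.+≤+ m≤n)) ⟩
  mkℚᵘ (+ n) 0  ≃⟨ toℚᵘ-⟦⟧ n ⟨
  toℚᵘ ⟦ n ⟧    ∎)
  where open ℚᵘ.≤-Reasoning

*⟦⟧-monoˡ-≤ : ∀ n {p q} → p ≤ q → p * ⟦ n ⟧ ≤ q * ⟦ n ⟧
*⟦⟧-monoˡ-≤ n = ℚ.*-monoʳ-≤-nonNeg ⟦ n ⟧ {{ℚ.normalize-nonNeg n 1}}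

⟦⟧*-monoʳ-≤ : ∀ n {p q} → p ≤ q → ⟦ n ⟧ * p ≤ ⟦ n ⟧ * q
⟦⟧*-monoʳ-≤ n = ℚ.*-monoˡ-≤-nonNeg ⟦ n ⟧ {{ℚ.normalize-nonNeg n 1}}

-- Turns the block counts, stated as products over the naturals, into multiples of `n / N₁` and
-- `n / N₂`.
⟦⟧≤*/ : ∀ {k c m n} .{{_ : NonZero n}} → k ℕ.* n ℕ.≤ c ℕ.* m → ⟦ k ⟧ ≤ ⟦ c ⟧ * (+ m / n)
⟦⟧≤*/ {k} {c} {m} {n} kn≤cm = ℚ.*-cancelʳ-≤-pos ⟦ n ⟧ {{ℚ.normalize-pos n 1}} (begin
  ⟦ k ⟧ * ⟦ n ⟧                ≡⟨ ⟦⟧-homo-* k n ⟨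
  ⟦ k ℕ.* n ⟧                  ≤⟨ ⟦⟧-mono-≤ kn≤cm ⟩
  ⟦ c ℕ.* m ⟧                  ≡⟨ ⟦⟧-homo-* c m ⟩
  ⟦ c ⟧ * ⟦ m ⟧                ≡⟨ cong (⟦ c ⟧ *_) (/-*-cancel m n) ⟨
  ⟦ c ⟧ * ((+ m / n) * ⟦ n ⟧)  ≡⟨ ℚ.*-assoc ⟦ c ⟧ (+ m / n) ⟦ n ⟧ ⟨
  ⟦ c ⟧ * (+ m / n) * ⟦ n ⟧    ∎)
  where open ℚ.≤-Reasoning

-- The absolute value changes nothing, because the floor of a non-negative number is non-negative.
⟦∣floor∣⟧≤ : ∀ w .{{_ : NonNegative w}} → ⟦ ℤ.∣ floor w ∣ ⟧ ≤ w
⟦∣floor∣⟧≤ w@(mkℚ (+ n) d _) = ℚ.toℚᵘ-cancel-≤ (begin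
  toℚᵘ ⟦ ℤ.∣ floor w ∣ ⟧      ≃⟨ toℚᵘ-⟦⟧ ℤ.∣ floor w ∣ ⟩
  mkℚᵘ (+ ℤ.∣ floor w ∣) 0    ≤⟨ *≤* floor*d≤n ⟩
  toℚᵘ w                      ∎)
  where
  open ℚᵘ.≤-Reasoning
  0≤floor : ℤ.0ℤ ℤ.≤ floor w
  0≤floor = ℤ.0≤n⇒0≤n/d (+ n) (+ suc d) (ℤ.+≤+ z≤n) (ℤ.+≤+ z≤n)
  floor*d≤n : + ℤ.∣ floor w ∣ ℤ.* + suc d ℤ.≤ + n ℤ.* + 1
  floor*d≤n = ℤ.≤-trans
    (ℤ.≤-reflexive (cong (ℤ._* + suc d) (ℤ.0≤i⇒+∣i∣≡i 0≤floor)))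
    (ℤ.≤-trans (ℤ.[n/d]*d≤n (+ n) (+ suc d)) (ℤ.≤-reflexive (sym (ℤ.*-identityʳ (+ n)))))

-- Consequences of small `ε` and large `n`

recip-pos : ∀ ε .{{_ : Positive ε}} → Positive (recip ε)
recip-pos ε = ℚ.1/pos⇒pos ε

1≤recip : ∀ {ε} .{{_ : Positive ε}} → ε ≤ 1ℚ → 1ℚ ≤ recip ε
1≤recip {ε} ε≤1 = begin
  1ℚ             ≡⟨ ℚ.*-inverseʳ ε {{ℚ.pos⇒nonZero ε}} ⟨
  ε * recip ε    ≤⟨ ℚ.*-monoʳ-≤-nonNeg (recip ε) {{ℚ.pos⇒nonNeg (recip ε) {{recip-pos ε}}}} ε≤1 ⟩
  1ℚ * recip ε   ≡⟨ ℚ.*-identityˡ (recip ε) ⟩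
  recip ε        ∎
  where open ℚ.≤-Reasoning

-- The centre of the window is absorbed by `1 ≤ w`, and rounding down only helps.
⟦1+2∣floor∣⟧≤3* : ∀ {w} → 1ℚ ≤ w → ⟦ 1 ℕ.+ 2 ℕ.* ℤ.∣ floor w ∣ ⟧ ≤ ⟦ 3 ⟧ * w
⟦1+2∣floor∣⟧≤3* {w} 1≤w = begin
  ⟦ 1 ℕ.+ 2 ℕ.* f ⟧       ≡⟨ ⟦⟧-homo-+ 1 (2 ℕ.* f) ⟩
  1ℚ + ⟦ 2 ℕ.* f ⟧        ≡⟨ cong (λ x → 1ℚ + x) (⟦⟧-homo-* 2 f) ⟩
  1ℚ + ⟦ 2 ⟧ * ⟦ f ⟧      ≤⟨ ℚ.+-mono-≤ 1≤w (⟦⟧*-monoʳ-≤ 2 (⟦∣floor∣⟧≤ w {{w≥0}})) ⟩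
  w + ⟦ 2 ⟧ * w           ≡⟨ cong (_+ ⟦ 2 ⟧ * w) (ℚ.*-identityˡ w) ⟨
  1ℚ * w + ⟦ 2 ⟧ * w      ≡⟨ ℚ.*-distribʳ-+ w 1ℚ ⟦ 2 ⟧ ⟨
  ⟦ 3 ⟧ * w               ∎
  where
  open ℚ.≤-Reasoning
  f = ℤ.∣ floor w ∣
  w≥0 : NonNegative w
  w≥0 = nonNegative (ℚ.≤-trans (⟦⟧-mono-≤ {0} {1} z≤n) 1≤w)

-- Every codeword decodes to a list containing itself.
listSize-nonZero : ∀ {a N M} {C : Code a N M} {ε L T} .{{_ : NonZero M}} →
                   ε ≤ 1ℚ → ListDecoder C ε L T → NonZero L
listSize-nonZero {N = N} {M = suc _} {C} {ε} ε≤1 D =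
  ℕ.>-nonZero (ℕ.≤-trans (∈-length zero∈) (listSize word))
  where
  open ListDecoder D
  open ℚ.≤-Reasoning
  word = Vec.toList (Code.codeword C zero)
  0≤1-ε : 0ℚ ≤ 1ℚ - ε
  0≤1-ε = ℚ.≤-trans (ℚ.≤-reflexive (sym (ℚ.+-inverseʳ ε))) (ℚ.+-monoˡ-≤ (- ε) ε≤1)
  0≤ : ⟦ 0 ⟧ ≤ ⟦ N ⟧ * (1ℚ - ε)
  0≤ = begin
    ⟦ 0 ⟧              ≡⟨ ℚ.*-zeroʳ ⟦ N ⟧ ⟨
    ⟦ N ⟧ * 0ℚ         ≤⟨ ⟦⟧*-monoʳ-≤ N 0≤1-ε ⟩
    ⟦ N ⟧ * (1ℚ - ε)   ∎
  zero∈ : zero ∈ result (decode word)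
  zero∈ = Equivalence.from (decode-∈ word zero) (0 , 0 , 0≤ , 0≤ , Turns.stop)

-- Both rounded logarithms are monotone, and at 4 their composite is 1.
loglog-nonZero : ∀ {n} → 4 ℕ.≤ n → NonZero (loglog n)
loglog-nonZero {n} 4≤n = ℕ.>-nonZero (⌊log₂⌋-mono-≤ (⌊log₂⌋-mono-≤ 4≤n))

-- From natural-number to rational bounds

-- There is one window for each of the two indices, each of size at most `3 * w`; together they
-- contribute the 9 in `K`.
rescale : ∀ {t w} B D T₁ T₂ c A W n ll {K r₁ r₂} →
  t ℕ.≤ B ℕ.* T₁ ℕ.+ D ℕ.* T₂ ℕ.+ c ℕ.* (n ℕ.* (A ℕ.* (W ℕ.* W)) ℕ.* ll) → .{{_ : NonNegative w}} →
  ⟦ B ⟧ ≤ ⟦ K ⟧ * r₁ → ⟦ D ⟧ ≤ ⟦ K ⟧ * r₂ → ⟦ W ⟧ ≤ ⟦ 3 ⟧ * w → K ≡ c ℕ.* 9 →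
  ⟦ t ⟧ ≤ ⟦ K ⟧ * (r₁ * ⟦ T₁ ⟧ + r₂ * ⟦ T₂ ⟧ + ⟦ A ⟧ * (w * w) * ⟦ n ℕ.* ll ⟧)
rescale {t} {w} B D T₁ T₂ c A W n ll {K} {r₁} {r₂} t≤ B≤ D≤ W≤ refl = begin
  ⟦ t ⟧
    ≤⟨ ⟦⟧-mono-≤ t≤ ⟩
  ⟦ B ℕ.* T₁ ℕ.+ D ℕ.* T₂ ℕ.+ c ℕ.* (n ℕ.* (A ℕ.* (W ℕ.* W)) ℕ.* ll) ⟧
    ≡⟨ trans (⟦⟧-homo-+ (B ℕ.* T₁ ℕ.+ D ℕ.* T₂) _) (cong₂ _+_
         (trans (⟦⟧-homo-+ (B ℕ.* T₁) (D ℕ.* T₂)) (cong₂ _+_ (⟦⟧-homo-* B T₁) (⟦⟧-homo-* D T₂))) work≡) ⟩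
  ⟦ B ⟧ * ⟦ T₁ ⟧ + ⟦ D ⟧ * ⟦ T₂ ⟧ + ⟦ c ℕ.* A ℕ.* (n ℕ.* ll) ⟧ * (⟦ W ⟧ * ⟦ W ⟧)
    ≤⟨ ℚ.+-mono-≤ (ℚ.+-mono-≤ (*⟦⟧-monoˡ-≤ T₁ B≤) (*⟦⟧-monoˡ-≤ T₂ D≤))
         (⟦⟧*-monoʳ-≤ (c ℕ.* A ℕ.* (n ℕ.* ll)) W²≤) ⟩
  ⟦ K ⟧ * r₁ * ⟦ T₁ ⟧ + ⟦ K ⟧ * r₂ * ⟦ T₂ ⟧ + ⟦ c ℕ.* A ℕ.* (n ℕ.* ll) ⟧ * (⟦ 9 ⟧ * (w * w))
    ≡⟨ cong (λ x → ⟦ K ⟧ * r₁ * ⟦ T₁ ⟧ + ⟦ K ⟧ * r₂ * ⟦ T₂ ⟧ + x) work′≡ ⟩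
  ⟦ K ⟧ * r₁ * ⟦ T₁ ⟧ + ⟦ K ⟧ * r₂ * ⟦ T₂ ⟧ + ⟦ K ⟧ * (⟦ A ⟧ * (w * w) * ⟦ n ℕ.* ll ⟧)
    ≡⟨ solve 6 (λ k r s x y z → k :* r :* x :+ k :* s :* y :+ k :* z := k :* (r :* x :+ s :* y :+ z)) refl
         ⟦ K ⟧ r₁ r₂ ⟦ T₁ ⟧ ⟦ T₂ ⟧ (⟦ A ⟧ * (w * w) * ⟦ n ℕ.* ll ⟧) ⟩
  ⟦ K ⟧ * (r₁ * ⟦ T₁ ⟧ + r₂ * ⟦ T₂ ⟧ + ⟦ A ⟧ * (w * w) * ⟦ n ℕ.* ll ⟧) ∎
  where
  open ℚ.≤-Reasoning
  open ℚ.+-*-Solver using (solve; _:*_; _:+_; _:=_)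
  regroup : ∀ c n A W ll → c ℕ.* (n ℕ.* (A ℕ.* (W ℕ.* W)) ℕ.* ll) ≡ c ℕ.* A ℕ.* (n ℕ.* ll) ℕ.* (W ℕ.* W)
  regroup = solve-∀
  work≡ : ⟦ c ℕ.* (n ℕ.* (A ℕ.* (W ℕ.* W)) ℕ.* ll) ⟧ ≡ ⟦ c ℕ.* A ℕ.* (n ℕ.* ll) ⟧ * (⟦ W ⟧ * ⟦ W ⟧)
  work≡ = trans (cong ⟦_⟧ (regroup c n A W ll))
    (trans (⟦⟧-homo-* (c ℕ.* A ℕ.* (n ℕ.* ll)) (W ℕ.* W)) (cong (⟦ c ℕ.* A ℕ.* (n ℕ.* ll) ⟧ *_) (⟦⟧-homo-* W W)))
  W²≤ : ⟦ W ⟧ * ⟦ W ⟧ ≤ ⟦ 9 ⟧ * (w * w)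
  W²≤ = begin
    ⟦ W ⟧ * ⟦ W ⟧              ≤⟨ ⟦⟧*-monoʳ-≤ W W≤ ⟩
    ⟦ W ⟧ * (⟦ 3 ⟧ * w)        ≤⟨ ℚ.*-monoʳ-≤-nonNeg (⟦ 3 ⟧ * w) {{ℚ.nonNeg*nonNeg⇒nonNeg ⟦ 3 ⟧ w}} W≤ ⟩
    ⟦ 3 ⟧ * w * (⟦ 3 ⟧ * w)    ≡⟨ solve 2 (λ k w → k :* w :* (k :* w) := k :* k :* (w :* w)) refl ⟦ 3 ⟧ w ⟩
    ⟦ 9 ⟧ * (w * w)            ∎
  work′≡ : ⟦ c ℕ.* A ℕ.* (n ℕ.* ll) ⟧ * (⟦ 9 ⟧ * (w * w)) ≡ ⟦ K ⟧ * (⟦ A ⟧ * (w * w) * ⟦ n ℕ.* ll ⟧)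
  work′≡ rewrite ⟦⟧-homo-* (c ℕ.* A) (n ℕ.* ll) | ⟦⟧-homo-* c A | ⟦⟧-homo-* c 9 =
    solve 5 (λ c a m k v → c :* a :* m :* (k :* v) := c :* k :* (a :* v :* m)) refl
      ⟦ c ⟧ ⟦ A ⟧ ⟦ n ℕ.* ll ⟧ ⟦ 9 ⟧ (w * w)

-- The bound for the given codes and strings

module _
  (HS : HuntSzymanski) (ε : ℚ) .{{_ : Positive ε}} (ε≤1 : ε ≤ 1ℚ)
  {a₁ a₂ M₁ M₂ N₂ L₁ L₂ : ℕ} {T₁ T₂ : ℕ → ℕ}
  .{{_ : NonZero M₁}} .{{_ : NonZero M₂}} .{{_ : NonZero N₂}}
  (C₁ : Code a₁ (M₂ ℕ.* N₂) M₁) (C₂ : Code a₂ N₂ M₂)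
  (D₁ : ListDecoder C₁ ε L₁ T₁) (D₂ : ListDecoder C₂ ε L₂ T₂)
  {Γ : Set} (_≟Γ_ : DecidableEquality Γ)
  (m : Vec Γ (M₁ ℕ.* (M₂ ℕ.* N₂)))
  {∣S′∣ : ℕ} (S′ : Vec (Symbol Γ a₁ a₂) ∣S′∣)
  where

  private
    N₁ n c W : ℕ
    N₁ = M₂ ℕ.* N₂
    n  = M₁ ℕ.* N₁ ⊔ ∣S′∣
    c  = 49 ℕ.+ 3 ℕ.* HuntSzymanski.constant HS
    W  = 1 ℕ.+ 2 ℕ.* ℤ.∣ floor (recip ε) ∣

    X≢0 : NonZero (N₁ ℕ./ N₂)
    -- `N₁ / N₂` is exactly `M₂`. Its `NonZero` instance is irrelevant, so a relevant one is rebuilt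
    -- from the inequality with 0.
    X≢0 = subst NonZero (sym (m*n/n≡m M₂ N₂)) (ℕ.≢-nonZero (ℕ.≢-nonZero⁻¹ M₂))

    module D₁ = ListDecoder D₁
    module D₂ = ListDecoder D₂
    module A = Analysis _≟Γ_ {a₁} {a₂} {M₁} {M₂} HS ε (zip m (indexString C₁ C₂)) S′
      N₁ N₂ {{ℕ.m*n≢0 M₂ N₂}} D₁.decode D₂.decode L₁ L₂ W (T₁ N₁) (T₂ N₂)
      {{listSize-nonZero ε≤1 D₁}} {{listSize-nonZero ε≤1 D₂}} {{_}} {{X≢0}}
      D₁.listSize D₂.listSize D₁.decodeTime D₂.decodeTime (length-window (recip ε))

  -- The 4 makes `loglog n` non-zero; the threshold makes the matching time bound applicable.
  running-time : 4 ⊔ HuntSzymanski.threshold HS ℕ.≤ n →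
    ⟦ time A.run ⟧ ≤ ⟦ c ℕ.* 9 ⟧ *
      ( (+ n / N₁) * ⟦ T₁ N₁ ⟧ + (+ n / N₂) * ⟦ T₂ N₂ ⟧
      + ⟦ N₂ ℕ.* L₁ ℕ.* L₂ ⟧ * (recip ε * recip ε) * ⟦ n ℕ.* loglog n ⟧)
  running-time n₀≤n =
    rescale {w = recip ε} A.B (suc A.B ℕ.* A.X) (T₁ N₁) (T₂ N₂) c (N₂ ℕ.* L₁ ℕ.* L₂) W n (loglog n)
      (A.time-run N₁≤n {{ll≢0}} large) {{ℚ.pos⇒nonNeg (recip ε) {{recip-pos ε}}}}
      -- The factors 2 and 3 of the block counts are enlarged to `c * 9`, so that a single constant
      -- serves all three terms.
      (⟦⟧≤*/ {A.B} {c ℕ.* 9} {n} {N₁}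
        (ℕ.≤-trans (A.B*N₁≤2n N₁≤n {{ll≢0}} large) (ℕ.*-monoˡ-≤ n (ℕ.≤-trans (ℕ.n≤1+n 2) 3≤K))))
      (⟦⟧≤*/ {suc A.B ℕ.* A.X} {c ℕ.* 9} {n} {N₂}
        (ℕ.≤-trans (A.[1+B]X*N₂≤3n N₁≤n {{ll≢0}} large) (ℕ.*-monoˡ-≤ n 3≤K)))
      (⟦1+2∣floor∣⟧≤3* {recip ε} (1≤recip ε≤1)) refl
    where
    3≤K : 3 ℕ.≤ c ℕ.* 9
    3≤K = s≤s (s≤s (s≤s z≤n))
    N₁≤n : N₁ ℕ.≤ n
    -- `S` consists of `M₁` blocks of length `N₁`, and `M₁` is non-zero.
    N₁≤n = ℕ.≤-trans (ℕ.m≤n*m N₁ M₁) (ℕ.m≤m⊔n (M₁ ℕ.* N₁) ∣S′∣)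
    large : HuntSzymanski.threshold HS ℕ.≤ n
    large = ℕ.≤-trans (ℕ.m≤n⊔m 4 (HuntSzymanski.threshold HS)) n₀≤n
    ll≢0 : NonZero (loglog n)
    ll≢0 = loglog-nonZero (ℕ.≤-trans (ℕ.m≤m⊔n 4 (HuntSzymanski.threshold HS)) n₀≤n)

theorem5p2 :
  ∃[ ε₀ ] (0ℚ < ε₀ × ((HS : HuntSzymanski) → ∃[ K ] ∃[ n₀ ]
    (∀ (ε : ℚ) .{{_ : Positive ε}} → ε ≤ ε₀ →
     ∀ {a₁ a₂ M₁ M₂ N₂ L₁ L₂ : ℕ} {T₁ T₂ : ℕ → ℕ}
       .{{_ : NonZero M₁}} .{{_ : NonZero M₂}} .{{_ : NonZero N₂}} →
     let N₁ = M₂ ℕ.* N₂ in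
     (C₁ : Code a₁ N₁ M₁) (C₂ : Code a₂ N₂ M₂) →
     (D₁ : ListDecoder C₁ ε L₁ T₁) (D₂ : ListDecoder C₂ ε L₂ T₂) →
     {Γ : Set} (_≟Γ_ : DecidableEquality Γ) →
     (m : Vec Γ (M₁ ℕ.* N₁)) →
     {∣S′∣ : ℕ} (S′ : Vec (Symbol Γ a₁ a₂) ∣S′∣) →
     let ∣S∣ = M₁ ℕ.* N₁
         S   = zip m (indexString C₁ C₂)
         n   = ∣S∣ ⊔ ∣S′∣
     in
     n₀ ℕ.≤ n →
     ⟦ time (EnhancedEDApprox.run _≟Γ_ HS ε S S′ N₁ N₂ (ListDecoder.decode D₁) (ListDecoder.decode D₂)) ⟧
       ≤ ⟦ K ⟧ * ( (+ n / N₁) * ⟦ T₁ N₁ ⟧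
                 + (+ n / N₂) * ⟦ T₂ N₂ ⟧
                 + ⟦ N₂ ℕ.* L₁ ℕ.* L₂ ⟧ * (recip ε * recip ε) * ⟦ n ℕ.* loglog n ⟧))))
theorem5p2 =
  -- With `ε₀ = 1`, `1 / ε` is at least 1 and `1 - ε` is non-negative, so that a codeword decodes to
  -- itself without edits.
  1ℚ , ℚ.positive⁻¹ 1ℚ , λ HS →
    (49 ℕ.+ 3 ℕ.* HuntSzymanski.constant HS) ℕ.* 9 , 4 ⊔ HuntSzymanski.threshold HS ,
    λ ε ε≤1 C₁ C₂ D₁ D₂ _≟Γ_ m S′ n₀≤n → running-time HS ε ε≤1 C₁ C₂ D₁ D₂ _≟Γ_ m S′ n₀≤n
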